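{- For every integer $k \geq 2$, there exists a $k$-de Bruijn L-array.
   Context: Fix an integer $k\ge 2$. Consider a $k \times k^2$ array $A$ with entries in $\{0,\dots,k-1\}$, with rows indexed by $i\in\{0,\dots,k-1\}$ and columns by $j\in\{0,\dots,k^2-1\}$, regarded cyclically (row indices taken mod $k$, column indices taken mod $k^2$, i.e. the left side is glued to the right side and the top to the bottom). An L-position is a pair $(i,j)$ with $0\le i\le k-1$, $0\le j\le k^2-1$; the L-filling read at $(i,j)$ is the triple $(a,b,d)=(A(i,j),\,A(i+1 \bmod k,\,j),\,A(i+1 \bmod k,\,j+1 \bmod k^2))$, i.e. a $2\times 2$ block with its upper-right cell removed: $a$ is the upper-left cell, $b$ the cell directly below $a$, and $d$ the cell directly to the right of $b$. There are $k^3$ L-positions and $k^3$ possible triples in $\{0,\dots,k-1\}^3$. The array $A$ is a $k$-de Bruijn L-array if every triple $(a,b,d)\in\{0,\dots,k-1\}^3$ is the L-filling read at exactly one L-position. -}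

module Defs where

open import Data.Fin.Base using (Fin; toℕ)
open import Data.Nat.Base using (ℕ; suc; _^_)
open import Data.Nat.DivMod using (_mod_)
open import Data.Product using (_×_; _,_; ∃!)
open import Relation.Binary.PropositionalEquality using (_≡_)

-- i ↦ i + 1 mod n
next : ∀ {n} → Fin n → Fin n
next {suc n} i = suc (toℕ i) mod suc n

Array : ℕ → Set
Array k = Fin k → Fin (k ^ 2) → Fin k

LPosition : ℕ → Set
LPosition k = Fin k × Fin (k ^ 2)

Triple : ℕ → Set
Triple k = Fin k × Fin k × Fin k

-- The first index of an array is the row, growing downwards; the second is
-- the column, growing to the right.  The filling lists the upper-left,
-- lower-left and lower-right cells of a cyclic 2 × 2 block.
filling : ∀ {k} → Array k → LPosition k → Triple k
filling A (i , j) = A i j , A (next i) j , A (next i) (next j)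

IsDeBruijnLArray : ∀ {k} → Array k → Set
IsDeBruijnLArray {k} A = (t : Triple k) → ∃! _≡_ λ (p : LPosition k) → filling A p ≡ t

{-# OPTIONS --safe #-}

-- Take A(i,j) = ⌊j/k⌋ + j·i mod k; this respects the cyclic identifications, as
-- j ↦ j + k² adds k + k²·i.  The cells a, b, d read at (i,j) satisfy
--   b − a = j   and   d − b = i + 1 + (⌊(j+1)/k⌋ − ⌊j/k⌋)   (mod k),
-- where the last bracket depends on j mod k only.  Hence (a,b,d) determines
-- successively j mod k, i, and ⌊j/k⌋ = a − j·i, and any triple is attained.
module Submission where

open import Defs
open import Data.Fin.Base using (Fin; toℕ; fromℕ<)
open import Data.Fin.Properties using (toℕ-injective; toℕ-fromℕ<; toℕ<n)
open import Data.Nat.Base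
open import Data.Nat.Divisibility using (divides)
open import Data.Nat.DivMod
open import Data.Nat.Properties
open import Data.Nat.Tactic.RingSolver using (solve-∀)
open import Data.Product using (_,_; ∃; _×_)
open import Relation.Binary.Bundles using (Setoid)
open import Relation.Binary.PropositionalEquality
import Relation.Binary.Reasoning.Setoid as SetoidReasoning

module _ (n : ℕ) where

  private
    k : ℕ
    k = suc n

  -- Arithmetic modulo `k` on natural numbers.

  infix 4 _≈_

  -- A record rather than a bare equation of remainders, so that unification can recover `x` and
  -- `y`, which `x % k` alone would not allow.
  record _≈_ (x y : ℕ) : Set where
    constructor congruent
    field %-≡ : x % k ≡ y % k

  open _≈_

  ≈-setoid : Setoid _ _
  ≈-setoid = record
    { Carrier = ℕ
    ; _≈_ = _≈_
    ; isEquivalence = record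
      { refl  = congruent refl
      ; sym   = λ p → congruent (sym (%-≡ p))
      ; trans = λ p q → congruent (trans (%-≡ p) (%-≡ q))
      }
    }

  open Setoid ≈-setoid using () renaming (refl to ≈-refl; sym to ≈-sym; trans to ≈-trans)
  open SetoidReasoning ≈-setoid

  %-≈ : ∀ x → x % k ≈ x
  %-≈ x = congruent (m%n%n≡m%n x k)

  +-*k-≈ : ∀ x c → x + c * k ≈ x
  +-*k-≈ x c = congruent ([m+kn]%n≡m%n x c k)

  +-cong-≈ : ∀ {x x′ y y′} → x ≈ x′ → y ≈ y′ → x + y ≈ x′ + y′
  +-cong-≈ {x} {x′} {y} {y′} p q = congruent
    (trans (%-distribˡ-+ x y k)
      (trans (cong₂ (λ u v → (u + v) % k) (%-≡ p) (%-≡ q))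
        (sym (%-distribˡ-+ x′ y′ k))))

  *-cong-≈ : ∀ {x x′ y y′} → x ≈ x′ → y ≈ y′ → x * y ≈ x′ * y′
  *-cong-≈ {x} {x′} {y} {y′} p q = congruent
    (trans (%-distribˡ-* x y k)
      (trans (cong₂ (λ u v → (u * v) % k) (%-≡ p) (%-≡ q))
        (sym (%-distribˡ-* x′ y′ k))))

  -- n ≡ −1 (mod k)
  +-n*-≈ : ∀ x y → x + y + n * y ≈ x
  +-n*-≈ x y = begin
    x + y + n * y  ≡⟨ lemma n x y ⟩
    x + y * k      ≈⟨ +-*k-≈ x y ⟩
    x              ∎
    where
    lemma : ∀ n x y → x + y + n * y ≡ x + y * suc n
    lemma = solve-∀

  -- As `n` stands for -1, adding `n * z` to both sides undoes the addition of `z`.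
  +-cancelʳ-≈ : ∀ {x y} z → x + z ≈ y + z → x ≈ y
  +-cancelʳ-≈ {x} {y} z p = begin
    x              ≈⟨ +-n*-≈ x z ⟨
    x + z + n * z  ≈⟨ +-cong-≈ p ≈-refl ⟩
    y + z + n * z  ≈⟨ +-n*-≈ y z ⟩
    y              ∎

  ≈⇒≡ : ∀ {x y} → x < k → y < k → x ≈ y → x ≡ y
  ≈⇒≡ x<k y<k p = trans (sym (m<n⇒m%n≡m x<k)) (trans (%-≡ p) (m<n⇒m%n≡m y<k))

  -- Subtraction without negative numbers: `x + n * y` represents x - y, and its remainder is the
  -- representative below `k`.
  difference : ∀ x y → ∃ λ z → z < k × z + y ≈ x
  difference x y = (x + n * y) % k , m%n<n (x + n * y) k , (begin
    (x + n * y) % k + y  ≈⟨ +-cong-≈ (%-≈ (x + n * y)) ≈-refl ⟩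
    x + n * y + y        ≡⟨ lemma x (n * y) y ⟩
    x + y + n * y        ≈⟨ +-n*-≈ x y ⟩
    x                    ∎)
    where
    lemma : ∀ x u y → x + u + y ≡ x + y + u
    lemma = solve-∀

  [m+c*k]/k : ∀ m c → (m + c * k) / k ≡ m / k + c
  [m+c*k]/k m c = trans (+-distrib-/-∣ʳ m (divides c refl)) (cong (m / k +_) (m*n/n≡m c k))

  suc-/ : ∀ j → suc j / k ≡ suc (j % k) / k + j / k
  suc-/ j = trans (cong (λ x → suc x / k) (m≡m%n+[m/n]*n j k)) ([m+c*k]/k (suc (j % k)) (j / k))

  -- The entries before reduction, and their cyclic behaviour.

  entry : ℕ → ℕ → ℕ
  entry i j = j / k + j * i

  entry-%ˡ : ∀ i j → entry (i % k) j ≈ entry i j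
  entry-%ˡ i j = +-cong-≈ ≈-refl (*-cong-≈ {j} ≈-refl (%-≈ i))

  entry-%ʳ : ∀ i j → entry i (j % k ^ 2) ≈ entry i j
  entry-%ʳ i j = begin
    -- The added multiple of `k` is the change of the entry over `q` turns around the array: `q * k`
    -- from the quotient and `q * k * k * i` from the product.
    r / k + r * i                            ≈⟨ +-*k-≈ (r / k + r * i) (q + q * k * i) ⟨
    r / k + r * i + (q + q * k * i) * k      ≡⟨ lemma k q r (r / k) i ⟩
    (r / k + q * k) + (r + (q * k) * k) * i  ≡⟨ cong (_+ (r + (q * k) * k) * i) ([m+c*k]/k r (q * k)) ⟨
    entry i (r + (q * k) * k)                ≡⟨ cong (entry i) j-split ⟨
    entry i j                                ∎
    where
    r = j % k ^ 2
    q = j / k ^ 2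
    lemma : ∀ k q r s i → s + r * i + (q + q * k * i) * k ≡ (s + q * k) + (r + (q * k) * k) * i
    lemma = solve-∀
    lemma′ : ∀ k q → q * (k * (k * 1)) ≡ (q * k) * k
    lemma′ = solve-∀
    j-split : j ≡ r + (q * k) * k
    j-split = trans (m≡m%n+[m/n]*n j (k ^ 2)) (cong (r +_) (lemma′ k q))

  entry-sucˡ : ∀ i j → entry (suc i) j ≡ j + entry i j
  entry-sucˡ i j = lemma i j (j / k)
    where
    lemma : ∀ i j q → q + j * suc i ≡ j + (q + j * i)
    lemma = solve-∀

  -- The growth of `j / k` from one column to the next, expressed through `j % k` so that congruent
  -- columns visibly share it.
  carry : ℕ → ℕ
  carry j = suc (j % k) / k

  -- Bracketed to isolate `i`: once `j % k` and the lower-left cell are known, the rest is a known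
  -- summand that can be subtracted.
  entry-sucʳ : ∀ i j → entry (suc i) (suc j) ≡ i + (suc (carry j) + entry (suc i) j)
  entry-sucʳ i j = trans (cong (_+ suc j * suc i) (suc-/ j)) (lemma i j (carry j) (j / k))
    where
    lemma : ∀ i j c q → c + q + suc j * suc i ≡ i + (suc c + (q + j * suc i))
    lemma = solve-∀

  -- From cells of the array to congruences and back.

  array : Array k
  array i j = entry (toℕ i) (toℕ j) mod k

  toℕ-mod : ∀ x m .{{_ : NonZero m}} → toℕ (x mod m) ≡ x % m
  toℕ-mod x m = toℕ-fromℕ< (m%n<n x m)

  mod-≡⇒≈ : ∀ {x} {t : Fin k} → x mod k ≡ t → x ≈ toℕ t
  mod-≡⇒≈ {x} refl = ≈-sym (≈-trans (congruent (cong (_% k) (toℕ-mod x k))) (%-≈ x))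

  ≈⇒mod-≡ : ∀ {x} {t : Fin k} → x ≈ toℕ t → x mod k ≡ t
  ≈⇒mod-≡ {x} {t} p = toℕ-injective
    (trans (toℕ-mod x k) (trans (%-≡ p) (m<n⇒m%n≡m (toℕ<n t))))

  entry-nextˡ : ∀ (i : Fin k) j → entry (toℕ (next i)) j ≈ entry (suc (toℕ i)) j
  entry-nextˡ i j = begin
    entry (toℕ (next i)) j     ≡⟨ cong (λ x → entry x j) (toℕ-mod (suc (toℕ i)) k) ⟩
    entry (suc (toℕ i) % k) j  ≈⟨ entry-%ˡ (suc (toℕ i)) j ⟩
    entry (suc (toℕ i)) j      ∎

  entry-nextʳ : ∀ i (j : Fin (k ^ 2)) → entry i (toℕ (next j)) ≈ entry i (suc (toℕ j))
  entry-nextʳ i j = begin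
    entry i (toℕ (next j))         ≡⟨ cong (entry i) (toℕ-mod (suc (toℕ j)) (k ^ 2)) ⟩
    entry i (suc (toℕ j) % k ^ 2)  ≈⟨ entry-%ʳ i (suc (toℕ j)) ⟩
    entry i (suc (toℕ j))          ∎

  -- With known cells substituted for entries, the system is triangular: the second congruence
  -- involves only `j % k`, the third brings in `i`, and the first brings in `j / k`.
  Reads : ℕ → ℕ → ℕ → ℕ → ℕ → Set
  Reads i j a b d = entry i j ≈ a × j + a ≈ b × i + (suc (carry j) + b) ≈ d

  filling⇒reads : ∀ i j {a b d} → filling array (i , j) ≡ (a , b , d) →
                  Reads (toℕ i) (toℕ j) (toℕ a) (toℕ b) (toℕ d)
  -- Matching `refl` turns `a`, `b`, `d` into the cells themselves, hence each `mod-≡⇒≈ refl` below.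
  filling⇒reads i j {a} {b} {d} refl = a-eq , b-eq , d-eq
    where
    x = toℕ i
    y = toℕ j
    a-eq : entry x y ≈ toℕ a
    a-eq = mod-≡⇒≈ refl
    b-eq′ : entry (suc x) y ≈ toℕ b
    b-eq′ = ≈-trans (≈-sym (entry-nextˡ i y)) (mod-≡⇒≈ refl)
    b-eq : y + toℕ a ≈ toℕ b
    b-eq = begin
      y + toℕ a        ≈⟨ +-cong-≈ {y} ≈-refl a-eq ⟨
      y + entry x y    ≡⟨ entry-sucˡ x y ⟨
      entry (suc x) y  ≈⟨ b-eq′ ⟩
      toℕ b            ∎
    d-eq : x + (suc (carry y) + toℕ b) ≈ toℕ d
    d-eq = begin
      x + (suc (carry y) + toℕ b)            ≈⟨ +-cong-≈ {x} ≈-refl (+-cong-≈ {suc (carry y)} ≈-refl b-eq′) ⟨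
      x + (suc (carry y) + entry (suc x) y)  ≡⟨ entry-sucʳ x y ⟨
      entry (suc x) (suc y)                  ≈⟨ entry-nextʳ (suc x) j ⟨
      entry (suc x) (toℕ (next j))           ≈⟨ entry-nextˡ i (toℕ (next j)) ⟨
      entry (toℕ (next i)) (toℕ (next j))    ≈⟨ mod-≡⇒≈ refl ⟩
      toℕ d                                  ∎

  reads⇒filling : ∀ i j {a b d} → Reads (toℕ i) (toℕ j) (toℕ a) (toℕ b) (toℕ d) →
                  filling array (i , j) ≡ (a , b , d)
  reads⇒filling i j {a} {b} {d} (a-eq , b-eq , d-eq) =
    cong₂ _,_ (≈⇒mod-≡ a-eq)
      (cong₂ _,_ (≈⇒mod-≡ (≈-trans (entry-nextˡ i y) b-eq′)) (≈⇒mod-≡ d-eq′))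
    where
    x = toℕ i
    y = toℕ j
    b-eq′ : entry (suc x) y ≈ toℕ b
    b-eq′ = begin
      entry (suc x) y  ≡⟨ entry-sucˡ x y ⟩
      y + entry x y    ≈⟨ +-cong-≈ {y} ≈-refl a-eq ⟩
      y + toℕ a        ≈⟨ b-eq ⟩
      toℕ b            ∎
    d-eq′ : entry (toℕ (next i)) (toℕ (next j)) ≈ toℕ d
    d-eq′ = begin
      entry (toℕ (next i)) (toℕ (next j))    ≈⟨ entry-nextˡ i (toℕ (next j)) ⟩
      entry (suc x) (toℕ (next j))           ≈⟨ entry-nextʳ (suc x) j ⟩
      entry (suc x) (suc y)                  ≡⟨ entry-sucʳ x y ⟩
      x + (suc (carry y) + entry (suc x) y)  ≈⟨ +-cong-≈ {x} ≈-refl (+-cong-≈ {suc (carry y)} ≈-refl b-eq′) ⟩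
      x + (suc (carry y) + toℕ b)            ≈⟨ d-eq ⟩
      toℕ d                                  ∎

  -- Solving the system, and uniqueness of the solution.

  k^2≡k*k : k ^ 2 ≡ k * k
  k^2≡k*k = cong (k *_) (*-identityʳ k)

  reads-exists : ∀ a b d → ∃ λ i → ∃ λ j → i < k × j < k ^ 2 × Reads i j a b d
  reads-exists a b d
    with g , g<k , g-eq ← difference b a
    -- The column is not yet chosen, but its carry is already that of its residue `g`.
    with i , i<k , i-eq ← difference d (suc (carry g) + b)
    with m , m<k , m-eq ← difference a (g * i)
    = i , j , i<k , j<k^2 , a-eq , ≈-trans (+-cong-≈ j≈g ≈-refl) g-eq , d-eq
    where
    -- As `g` and `m` are below `k`, they are the two base-`k` digits of the column.
    j = g + m * k
    j≈g : j ≈ g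
    j≈g = +-*k-≈ g m
    j/k≡m : j / k ≡ m
    j/k≡m = trans ([m+c*k]/k g m) (cong (_+ m) (m<n⇒m/n≡0 g<k))
    j<k^2 : j < k ^ 2
    j<k^2 = subst (j <_) (sym k^2≡k*k) (<-≤-trans (+-monoˡ-< (m * k) g<k) (*-monoˡ-≤ k m<k))
    a-eq : entry i j ≈ a
    a-eq = begin
      j / k + j * i  ≡⟨ cong (_+ j * i) j/k≡m ⟩
      m + j * i      ≈⟨ +-cong-≈ {m} ≈-refl (*-cong-≈ j≈g ≈-refl) ⟩
      m + g * i      ≈⟨ m-eq ⟩
      a              ∎
    d-eq : i + (suc (carry j) + b) ≈ d
    d-eq = subst (λ r → i + (suc (suc r / k) + b) ≈ d) (sym (%-≡ j≈g)) i-eq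

  reads-unique : ∀ {i j i′ j′ a b d} → i < k → i′ < k → j < k ^ 2 → j′ < k ^ 2 →
                 Reads i j a b d → Reads i′ j′ a b d → i ≡ i′ × j ≡ j′
  reads-unique {i} {j} {i′} {j′} {a} {b} {d} i<k i′<k j<k^2 j′<k^2
    (a-eq , b-eq , d-eq) (a-eq′ , b-eq′ , d-eq′) = i≡i′ , j≡j′
    where
    j≈j′ : j ≈ j′
    j≈j′ = +-cancelʳ-≈ a (≈-trans b-eq (≈-sym b-eq′))
    i≡i′ : i ≡ i′
    i≡i′ = ≈⇒≡ i<k i′<k (+-cancelʳ-≈ (suc (carry j) + b) (≈-trans d-eq
      -- Replacing `carry j′` by `carry j` gives both sides the same summand to cancel.
      (≈-sym (subst (λ r → i′ + (suc (suc r / k) + b) ≈ d) (sym (%-≡ j≈j′)) d-eq′))))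
    -- The number of columns enters here: quotients below `k` that are congruent are equal.
    quotient<k : ∀ {x} → x < k ^ 2 → x / k < k
    quotient<k {x} x<k^2 = m<n*o⇒m/o<n (subst (x <_) k^2≡k*k x<k^2)
    j/k≡j′/k : j / k ≡ j′ / k
    j/k≡j′/k = ≈⇒≡ (quotient<k j<k^2) (quotient<k j′<k^2) (+-cancelʳ-≈ (j * i) (begin
      j / k + j * i     ≈⟨ a-eq ⟩
      a                 ≈⟨ a-eq′ ⟨
      j′ / k + j′ * i′  ≡⟨ cong (λ x → j′ / k + j′ * x) i≡i′ ⟨
      j′ / k + j′ * i   ≈⟨ +-cong-≈ {j′ / k} ≈-refl (*-cong-≈ j≈j′ ≈-refl) ⟨
      j′ / k + j * i    ∎))
    j≡j′ : j ≡ j′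
    j≡j′ = trans (m≡m%n+[m/n]*n j k)
      (trans (cong₂ (λ r q → r + q * k) (%-≡ j≈j′) j/k≡j′/k) (sym (m≡m%n+[m/n]*n j′ k)))

  array-isDeBruijn : IsDeBruijnLArray array
  array-isDeBruijn (a , b , d)
    with i , j , i<k , j<k^2 , reads ← reads-exists (toℕ a) (toℕ b) (toℕ d)
    = (fromℕ< i<k , fromℕ< j<k^2) , reads⇒filling _ _ reads′ , unique
    where
    reads′ : Reads (toℕ (fromℕ< i<k)) (toℕ (fromℕ< j<k^2)) (toℕ a) (toℕ b) (toℕ d)
    reads′ = subst₂ (λ x y → Reads x y (toℕ a) (toℕ b) (toℕ d))
      (sym (toℕ-fromℕ< i<k)) (sym (toℕ-fromℕ< j<k^2)) reads
    unique : ∀ {p} → filling array p ≡ (a , b , d) → (fromℕ< i<k , fromℕ< j<k^2) ≡ p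
    unique {i′ , j′} eq
      with i≡i′ , j≡j′ ← reads-unique (toℕ<n (fromℕ< i<k)) (toℕ<n i′) (toℕ<n (fromℕ< j<k^2)) (toℕ<n j′)
                           reads′ (filling⇒reads i′ j′ eq)
      = cong₂ _,_ (toℕ-injective i≡i′) (toℕ-injective j≡j′)

theorem2 : (k : ℕ) → k ≥ 2 → ∃ λ (A : Array k) → IsDeBruijnLArray A
theorem2 (suc n) _ = array n , array-isDeBruijn n
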